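{- There is an absolute constant $c>0$ such that for all sufficiently large $n$, every integer $p$ with $1\le p\le \log n$, and every increment sequence $h_1,\ldots,h_p$ of positive integers with $h_p=1$, the following holds. Let $\pi$ be a uniformly random permutation of $\{1,\ldots,n\}$, and run $p$-pass Shellsort with increments $h_1,\ldots,h_p$ on $\pi$. Then the expected total number of inversions (data movements) performed, summed over all $p$ passes, is at least $c\, p\, n^{1+1/p}$. In other words, the average number of inversions is $\Omega\left(p n^{1+1/p}\right)$.
   Context: $\log$ denotes the binary logarithm. $p$-pass Shellsort with increments $h_1,\ldots,h_p$ (positive integers, $h_p=1$) sorts a list $a_1,\ldots,a_n$ into increasing order in $p$ passes. In pass $k$ ($k=1,\ldots,p$), for each $r\in\{1,\ldots,h_k\}$ the sublist (the "$h_k$-chain") consisting of the entries at positions $j$ with $j\equiv r \pmod{h_k}$ is sorted by straight insertion sort, in place within those positions. For an element $i$ and pass $k$, let $m_{i,k}$ be the number of elements in the $h_k$-chain containing $i$ that lie to the left of $i$ and are larger than $i$ at the beginning of pass $k$. The number of inversions (data movements) performed in pass $k$ is $\sum_{i=1}^n m_{i,k}$, i.e. the number of inversions inside the chains at the start of pass $k$. The total number of inversions is $M=\sum_{i=1}^n\sum_{k=1}^p m_{i,k}$. The constant $c$ does not depend on $n$, $p$ or the increments. -}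

module Defs where

open import Data.Nat using (ℕ; zero; suc; _+_; _*_; _<_; _<?_; ∣_-_∣; _≤ᵇ_)
open import Data.Nat.Divisibility using (_∣?_)
open import Data.List using (List; []; _∷_; map; filter; length; upTo; concatMap)
open import Data.Nat.ListAction using (sum)
open import Data.Bool using (if_then_else_)
open import Relation.Nullary.Decidable using (_×-dec_)

-- Lists are 0-indexed internally: position j of a list of length n is j ∈ {0,…,n-1}.
-- Entry at position j (default 0 outside the range; never used out of range).
at : List ℕ → ℕ → ℕ
at []       _       = 0
at (x ∷ xs) zero    = x
at (x ∷ xs) (suc j) = at xs j

insert : ℕ → List ℕ → List ℕ
insert x []       = x ∷ []
insert x (y ∷ ys) = if x ≤ᵇ y then x ∷ y ∷ ys else y ∷ insert x ys

insertionSort : List ℕ → List ℕ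
insertionSort []       = []
insertionSort (x ∷ xs) = insert x (insertionSort xs)

chainPositions : ℕ → ℕ → ℕ → List ℕ
chainPositions h n j = filter (λ i → h ∣? ∣ i - j ∣) (upTo n)

chainOf : ℕ → List ℕ → ℕ → List ℕ
chainOf h xs j = map (at xs) (chainPositions h (length xs) j)

-- Rank of position j inside its chain (number of chain positions to its left).
rankInChain : ℕ → ℕ → ℕ
rankInChain h j = length (chainPositions h j j)

-- One pass of Shellsort with increment h: every h-chain is sorted by insertion
-- sort, in place within its positions.
pass : ℕ → List ℕ → List ℕ
pass h xs = map (λ j → at (insertionSort (chainOf h xs j)) (rankInChain h j)) (upTo (length xs))

mPos : ℕ → List ℕ → ℕ → ℕ
mPos h xs j = length (filter (λ i → (h ∣? ∣ i - j ∣) ×-dec (at xs j <? at xs i)) (upTo j))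

passInversions : ℕ → List ℕ → ℕ
passInversions h xs = sum (map (mPos h xs) (upTo (length xs)))

shellInversions : List ℕ → List ℕ → ℕ
shellInversions []       xs = 0
shellInversions (h ∷ hs) xs = passInversions h xs + shellInversions hs (pass h xs)

insertAll : ℕ → List ℕ → List (List ℕ)
insertAll x []       = (x ∷ []) ∷ []
insertAll x (y ∷ ys) = (x ∷ y ∷ ys) ∷ map (y ∷_) (insertAll x ys)

perms : List ℕ → List (List ℕ)
perms []       = [] ∷ []
perms (x ∷ xs) = concatMap (insertAll x) (perms xs)

permutationsOf : ℕ → List (List ℕ)
permutationsOf n = perms (map suc (upTo n))

-- Sum of M over all permutations of {1,…,n}  (= n! · expected M for uniform π).
totalInversions : List ℕ → ℕ → ℕ
totalInversions hs n = sum (map (shellInversions hs) (permutationsOf n))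

{-# OPTIONS --safe #-}
module Submission where

-- The numbers of elements passed over, recorded for every pass and every
-- position, determine the input permutation: the last pass leaves the sorted
-- list, and a pass can be undone because in each chain these numbers are the
-- inversion table, which together with the sorted chain gives the chain back.
-- So the permutations with at most K
-- inversions inject into the lists of p n naturals with sum at most K, of which
-- there are (K + p n) C (p n).  For a suitable K of order p n^(1+1/p) this is at
-- most n! / 2, so half of the permutations need more than K inversions.
-- When n^(1/p) ≥ 32, K = r p n with r close to n^(1/p) / 32 works; otherwise
-- K = p n / 8 does, by 2^p ≤ n.

open import Defs
open import Data.Bool using (true; false)
open import Data.Empty using (⊥-elim)
open import Data.List using (List; []; _∷_; _∷ʳ_; _++_; length; map; filter; upTo; applyUpTo; take; concatMap)
open import Data.List.Membership.Propositional using (_∈_)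
open import Data.List.Membership.Propositional.Properties using (∈-upTo⁻; ∈-filter⁻; ∈-++⁺ˡ; ∈-++⁺ʳ; ∈-map⁺; ∈-map⁻; ∈-∃++)
open import Data.List.Properties hiding (sum-++)
open import Data.List.Relation.Binary.Disjoint.Propositional using (Disjoint)
open import Data.List.Relation.Binary.Permutation.Propositional using (_↭_; refl; prep; swap; trans; ↭-refl; ↭-sym; ↭-trans; ↭-reflexive; module PermutationReasoning)
import Data.List.Relation.Binary.Permutation.Propositional.Properties as ↭
open import Data.List.Relation.Unary.All as All using (All; []; _∷_)
import Data.List.Relation.Unary.All.Properties as All
open import Data.List.Relation.Unary.AllPairs using (AllPairs; []; _∷_)
open import Data.List.Relation.Unary.Any using (here; there)
open import Data.List.Relation.Unary.Unique.Propositional using (Unique)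
import Data.List.Relation.Unary.Unique.Propositional.Properties as Unique
open import Data.Nat
open import Data.Nat.Divisibility using (_∣_; _∣?_; divides; 1∣_)
open import Data.Nat.DivMod using (m≡m%n+[m/n]*n; m/n*n≤m; %-remove-+ʳ; m%n<n; m<n⇒m%n≡m)
open import Data.Nat.ListAction using (sum)
open import Data.Nat.ListAction.Properties using (sum-++)
open import Data.Nat.Properties
open import Data.Nat.Solver using (module +-*-Solver)
open import Data.Product using (Σ; _×_; _,_; proj₁; proj₂)
open import Data.Sum using (_⊎_; inj₁; inj₂; [_,_]′)
open import Function using (_∘_; flip)
open import Level using (Level)
open import Relation.Binary.Definitions using (tri<; tri≈; tri>)
open import Relation.Binary.PropositionalEquality as ≡ using (_≡_; _≢_; cong; cong₂; sym; subst; module ≡-Reasoning)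
open import Relation.Nullary using (¬_; yes; no; ¬?; contradiction)
open import Relation.Nullary.Decidable using (_×-dec_)
open import Relation.Unary using (Pred; Decidable)

private
  variable
    ℓ₁ ℓ₂ ℓ₃ : Level

-- Lists as functions of position, and filtered ranges

map-at-upTo : ∀ xs → map (at xs) (upTo (length xs)) ≡ xs
map-at-upTo []       = ≡.refl
map-at-upTo (x ∷ xs) = cong (x ∷_) (begin
  map (at (x ∷ xs)) (applyUpTo suc (length xs)) ≡⟨ map-applyUpTo suc (at (x ∷ xs)) (length xs) ⟩
  applyUpTo (at xs) (length xs)                 ≡⟨ map-upTo (at xs) (length xs) ⟨
  map (at xs) (upTo (length xs))                          ≡⟨ map-at-upTo xs ⟩
  xs                                                      ∎)
  where open ≡-Reasoning

at-map-upTo : ∀ f {n} i → i < n → at (map f (upTo n)) i ≡ f i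
at-map-upTo f {n} i i<n = ≡.trans (cong (λ l → at l i) (map-upTo f n)) (go f n i i<n)
  where
  go : ∀ f n i → i < n → at (applyUpTo f n) i ≡ f i
  go f (suc n) zero    _         = ≡.refl
  go f (suc n) (suc i) (s≤s i<n) = go (f ∘ suc) n i i<n

map-cong-∈ : ∀ {B : Set} {f g : ℕ → B} xs → (∀ {x} → x ∈ xs → f x ≡ g x) → map f xs ≡ map g xs
map-cong-∈ xs eq = map-cong-local (All.tabulate eq)

at-ext : ∀ xs ys → length xs ≡ length ys → (∀ i → i < length xs → at xs i ≡ at ys i) → xs ≡ ys
at-ext xs ys len eq = begin
  xs                             ≡⟨ map-at-upTo xs ⟨
  map (at xs) (upTo (length xs)) ≡⟨ map-cong-∈ _ (λ {i} i∈ → eq i (∈-upTo⁻ i∈)) ⟩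
  map (at ys) (upTo (length xs)) ≡⟨ cong (map (at ys) ∘ upTo) len ⟩
  map (at ys) (upTo (length ys)) ≡⟨ map-at-upTo ys ⟩
  ys                             ∎
  where open ≡-Reasoning

-- A permutation and not an equality, because the concatenation separates elements that are
-- interleaved in `xs`. It serves to split off one residue class of positions at a time.
filter-⊎ : ∀ {A : Set} {P : Pred A ℓ₁} {Q : Pred A ℓ₂} {R : Pred A ℓ₃}
           (P? : Decidable P) (Q? : Decidable Q) (R? : Decidable R) →
           (∀ {x} → Q x → P x) → (∀ {x} → R x → P x) → (∀ {x} → P x → Q x ⊎ R x) →
           (∀ {x} → Q x → ¬ R x) →
           ∀ xs → filter P? xs ↭ filter Q? xs ++ filter R? xs
filter-⊎ P? Q? R? q⇒p r⇒p p⇒q⊎r ¬q×r []       = ↭-refl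
filter-⊎ P? Q? R? q⇒p r⇒p p⇒q⊎r ¬q×r (x ∷ xs)
  with P? x | Q? x | R? x | filter-⊎ P? Q? R? q⇒p r⇒p p⇒q⊎r ¬q×r xs
... | yes _  | yes _  | no _   | ih = prep x ih
... | yes _  | no _   | yes _  | ih = ↭-trans (prep x ih) (↭-sym (↭.shift x _ _))
... | no _   | no _   | no _   | ih = ih
... | yes px | no ¬qx | no ¬rx | _  = ⊥-elim ([ ¬qx , ¬rx ]′ (p⇒q⊎r px))
... | _      | yes qx | yes rx | _  = contradiction rx (¬q×r qx)
... | no ¬px | yes qx | _      | _  = contradiction (q⇒p qx) ¬px
... | no ¬px | _      | yes rx | _  = contradiction (r⇒p rx) ¬px

module _ {A : Set} {P : Pred A ℓ₁} {Q : Pred A ℓ₂}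
         (P? : Decidable P) (Q? : Decidable Q) (P⊆Q : ∀ {x} → P x → Q x) where

  length-filter-≤ : ∀ xs → length (filter P? xs) ≤ length (filter Q? xs)
  length-filter-≤ [] = z≤n
  length-filter-≤ (x ∷ xs) with P? x | Q? x
  ... | yes _  | yes _  = s≤s (length-filter-≤ xs)
  ... | no _   | yes _  = m≤n⇒m≤1+n (length-filter-≤ xs)
  ... | no _   | no _   = length-filter-≤ xs
  ... | yes px | no ¬qx = contradiction (P⊆Q px) ¬qx

  length-filter-< : ∀ {x xs} → x ∈ xs → ¬ P x → Q x → length (filter P? xs) < length (filter Q? xs)
  length-filter-< {xs = x ∷ xs} (here ≡.refl) ¬px qx with P? x | Q? x
  ... | yes px | _      = contradiction px ¬px
  ... | _      | no ¬qx = contradiction qx ¬qx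
  ... | no _   | yes _  = s≤s (length-filter-≤ xs)
  length-filter-< {xs = x ∷ xs} (there x∈xs) ¬py qy with P? x | Q? x
  ... | yes _  | yes _  = s≤s (length-filter-< x∈xs ¬py qy)
  ... | no _   | yes _  = m<n⇒m<1+n (length-filter-< x∈xs ¬py qy)
  ... | no _   | no _   = length-filter-< x∈xs ¬py qy
  ... | yes px | no ¬qx = contradiction (P⊆Q px) ¬qx

module _ {P : Pred ℕ ℓ₁} (P? : Decidable P) where

  filter-upTo-accept : ∀ {n} → P n → filter P? (upTo (suc n)) ≡ filter P? (upTo n) ∷ʳ n
  filter-upTo-accept {n} pn = begin
    filter P? (upTo (suc n))                ≡⟨ cong (filter P?) (upTo-∷ʳ n) ⟨
    filter P? (upTo n ∷ʳ n)                 ≡⟨ filter-++ P? (upTo n) (n ∷ []) ⟩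
    filter P? (upTo n) ++ filter P? (n ∷ [])
      ≡⟨ cong (filter P? (upTo n) ++_) (filter-accept P? pn) ⟩
    filter P? (upTo n) ∷ʳ n                 ∎
    where open ≡-Reasoning

  filter-upTo-reject : ∀ {n} → ¬ P n → filter P? (upTo (suc n)) ≡ filter P? (upTo n)
  filter-upTo-reject {n} ¬pn = begin
    filter P? (upTo (suc n))                 ≡⟨ cong (filter P?) (upTo-∷ʳ n) ⟨
    filter P? (upTo n ∷ʳ n)                  ≡⟨ filter-++ P? (upTo n) (n ∷ []) ⟩
    filter P? (upTo n) ++ filter P? (n ∷ [])
      ≡⟨ cong (filter P? (upTo n) ++_) (filter-reject P? ¬pn) ⟩
    filter P? (upTo n) ++ []                 ≡⟨ ++-identityʳ _ ⟩
    filter P? (upTo n)                       ∎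
    where open ≡-Reasoning

  -- The selected numbers have ranks 0, 1, 2, ... among themselves, so reading `L` at these ranks
  -- reads it from the front.
  map-at-rank : ∀ L n → length (filter P? (upTo n)) ≤ length L →
                map (λ i → at L (length (filter P? (upTo i)))) (filter P? (upTo n))
                  ≡ take (length (filter P? (upTo n))) L
  map-at-rank L zero    _  = ≡.refl
  map-at-rank L (suc n) le with P? n
  ... | no ¬pn rewrite filter-upTo-reject ¬pn = map-at-rank L n le
  ... | yes pn rewrite filter-upTo-accept pn
                     | map-++ (λ i → at L (length (filter P? (upTo i)))) (filter P? (upTo n)) (n ∷ [])
                     | length-++ (filter P? (upTo n)) {n ∷ []}
                     | +-comm (length (filter P? (upTo n))) 1
                     = ≡.trans (cong (_∷ʳ at L (length (filter P? (upTo n)))) (map-at-rank L n (<⇒≤ le)))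
                               (take-at L le)
    where
    take-at : ∀ L {k} → k < length L → take k L ∷ʳ at L k ≡ take (suc k) L
    take-at (x ∷ L) {zero}  _         = ≡.refl
    take-at (x ∷ L) {suc k} (s≤s k<l) = cong (x ∷_) (take-at L k<l)

-- Insertion sort depends only on the multiset

insert-↭ : ∀ x xs → insert x xs ↭ x ∷ xs
insert-↭ x []       = ↭-refl
insert-↭ x (y ∷ ys) with x ≤ᵇ y
... | true  = ↭-refl
... | false = ↭-trans (prep y (insert-↭ x ys)) (swap y x ↭-refl)

insertionSort-↭ : ∀ xs → insertionSort xs ↭ xs
insertionSort-↭ []       = ↭-refl
insertionSort-↭ (x ∷ xs) = ↭-trans (insert-↭ x (insertionSort xs)) (prep x (insertionSort-↭ xs))

insert-≤ : ∀ {x y} ys → x ≤ y → insert x (y ∷ ys) ≡ x ∷ y ∷ ys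
insert-≤ {x} {y} ys x≤y with x ≤ᵇ y | ≤⇒≤ᵇ x≤y
... | true | _ = ≡.refl

insert-> : ∀ {x y} ys → y < x → insert x (y ∷ ys) ≡ y ∷ insert x ys
insert-> {x} {y} ys y<x with x ≤ᵇ y | ≤ᵇ⇒≤ x y
... | true  | x≤y = contradiction (x≤y _) (<⇒≱ y<x)
... | false | _   = ≡.refl

-- An insertion stops at the first entry that is not smaller, so `x` never gets further than `y`;
-- where both stop at the same entry, either order of insertion leaves `x` directly in front of `y`.
insert-comm-< : ∀ {x y} → x < y → ∀ zs → insert x (insert y zs) ≡ insert y (insert x zs)
insert-comm-< x<y [] = ≡.trans (insert-≤ [] (<⇒≤ x<y)) (sym (insert-> [] x<y))
insert-comm-< {x} {y} x<y (z ∷ zs) with ≤-<-connex y z | ≤-<-connex x z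
... | inj₁ y≤z | inj₂ z<x = contradiction (<-trans z<x x<y) (≤⇒≯ y≤z)
... | inj₁ y≤z | inj₁ x≤z = begin
  insert x (insert y (z ∷ zs)) ≡⟨ cong (insert x) (insert-≤ zs y≤z) ⟩
  insert x (y ∷ z ∷ zs)        ≡⟨ insert-≤ (z ∷ zs) (<⇒≤ x<y) ⟩
  x ∷ y ∷ z ∷ zs               ≡⟨ cong (x ∷_) (insert-≤ zs y≤z) ⟨
  x ∷ insert y (z ∷ zs)        ≡⟨ insert-> (z ∷ zs) x<y ⟨
  insert y (x ∷ z ∷ zs)        ≡⟨ cong (insert y) (insert-≤ zs x≤z) ⟨
  insert y (insert x (z ∷ zs)) ∎
  where open ≡-Reasoning
... | inj₂ z<y | inj₁ x≤z = begin
  insert x (insert y (z ∷ zs)) ≡⟨ cong (insert x) (insert-> zs z<y) ⟩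
  insert x (z ∷ insert y zs)   ≡⟨ insert-≤ (insert y zs) x≤z ⟩
  x ∷ z ∷ insert y zs          ≡⟨ cong (x ∷_) (insert-> zs z<y) ⟨
  x ∷ insert y (z ∷ zs)        ≡⟨ insert-> (z ∷ zs) x<y ⟨
  insert y (x ∷ z ∷ zs)        ≡⟨ cong (insert y) (insert-≤ zs x≤z) ⟨
  insert y (insert x (z ∷ zs)) ∎
  where open ≡-Reasoning
... | inj₂ z<y | inj₂ z<x = begin
  insert x (insert y (z ∷ zs)) ≡⟨ cong (insert x) (insert-> zs z<y) ⟩
  insert x (z ∷ insert y zs)   ≡⟨ insert-> (insert y zs) z<x ⟩
  z ∷ insert x (insert y zs)   ≡⟨ cong (z ∷_) (insert-comm-< x<y zs) ⟩
  z ∷ insert y (insert x zs)   ≡⟨ insert-> (insert x zs) z<y ⟨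
  insert y (z ∷ insert x zs)   ≡⟨ cong (insert y) (insert-> zs z<x) ⟨
  insert y (insert x (z ∷ zs)) ∎
  where open ≡-Reasoning

insert-comm : ∀ x y zs → insert x (insert y zs) ≡ insert y (insert x zs)
insert-comm x y zs with <-cmp x y
... | tri< x<y _ _ = insert-comm-< x<y zs
... | tri≈ _ ≡.refl _ = ≡.refl
... | tri> _ _ y<x = sym (insert-comm-< y<x zs)

-- Insertions commute. This is the form in which sortedness enters the proof: all rearrangements of
-- a list have one common sorted list.
insertionSort-cong-↭ : ∀ {xs ys} → xs ↭ ys → insertionSort xs ≡ insertionSort ys
insertionSort-cong-↭ refl        = ≡.refl
insertionSort-cong-↭ (prep x e)  = cong (insert x) (insertionSort-cong-↭ e)
insertionSort-cong-↭ (swap {xs} x y e) =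
  ≡.trans (insert-comm x y (insertionSort xs)) (cong (insert y ∘ insert x) (insertionSort-cong-↭ e))
insertionSort-cong-↭ (trans e f) = ≡.trans (insertionSort-cong-↭ e) (insertionSort-cong-↭ f)

-- Chains as residue classes, and the effect of a pass on them

module _ (h : ℕ) .{{_ : NonZero h}} where

  ∣-∣⇒%≡ : ∀ i j → h ∣ ∣ i - j ∣ → i % h ≡ j % h
  ∣-∣⇒%≡ i j d with ≤-total i j
  ... | inj₁ i≤j = sym (≡.trans (cong (_% h) (sym (m+[n∸m]≡n i≤j)))
                          (%-remove-+ʳ i (subst (h ∣_) (m≤n⇒∣m-n∣≡n∸m i≤j) d)))
  ... | inj₂ j≤i = ≡.trans (cong (_% h) (sym (m+[n∸m]≡n j≤i)))
                          (%-remove-+ʳ j (subst (h ∣_) (m≤n⇒∣n-m∣≡n∸m j≤i) d))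

  %≡⇒∣-∣ : ∀ i j → i % h ≡ j % h → h ∣ ∣ i - j ∣
  %≡⇒∣-∣ i j eq = divides ∣ i / h - j / h ∣ (begin
    ∣ i - j ∣
      ≡⟨ cong₂ ∣_-_∣ (m≡m%n+[m/n]*n i h) (m≡m%n+[m/n]*n j h) ⟩
    ∣ i % h + i / h * h - (j % h + j / h * h) ∣
      ≡⟨ cong (λ r → ∣ i % h + i / h * h - (r + j / h * h) ∣) eq ⟨
    ∣ i % h + i / h * h - (i % h + j / h * h) ∣   ≡⟨ ∣m+n-m+o∣≡∣n-o∣ (i % h) _ _ ⟩
    ∣ i / h * h - j / h * h ∣                     ≡⟨ *-distribʳ-∣-∣ h (i / h) (j / h) ⟨
    ∣ i / h - j / h ∣ * h                         ∎)
    where open ≡-Reasoning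

  chainPositions-cong : ∀ n i j → h ∣ ∣ i - j ∣ → chainPositions h n i ≡ chainPositions h n j
  chainPositions-cong n i j d = flip (filter-≐ _ _) (upTo n) (
    (λ {k} e → %≡⇒∣-∣ k j (≡.trans (∣-∣⇒%≡ k i e) (∣-∣⇒%≡ i j d))) ,
    (λ {k} e → %≡⇒∣-∣ k i (≡.trans (∣-∣⇒%≡ k j e) (sym (∣-∣⇒%≡ i j d)))))

  chainOf-cong : ∀ xs i j → h ∣ ∣ i - j ∣ → chainOf h xs i ≡ chainOf h xs j
  chainOf-cong xs i j d = cong (map (at xs)) (chainPositions-cong (length xs) i j d)

length-pass : ∀ h xs → length (pass h xs) ≡ length xs
length-pass h xs = ≡.trans (length-map _ (upTo (length xs))) (length-upTo (length xs))

module _ (h : ℕ) .{{_ : NonZero h}} where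

  -- All positions of a chain share one sorted chain, and each takes from it the entry at its own
  -- rank; these ranks are 0, 1, 2, ..., so `map-at-rank` applies.
  chainOf-pass : ∀ xs j → chainOf h (pass h xs) j ≡ insertionSort (chainOf h xs j)
  chainOf-pass xs j = begin
    map (at (pass h xs)) (chainPositions h (length (pass h xs)) j)
      ≡⟨ cong (λ m → map (at (pass h xs)) (chainPositions h m j)) (length-pass h xs) ⟩
    map (at (pass h xs)) P
      ≡⟨ map-cong-∈ P entry ⟩
    map (λ i → at S (length (chainPositions h i j))) P
      ≡⟨ map-at-rank (λ i → h ∣? ∣ i - j ∣) S (length xs) (≤-reflexive (sym lenS)) ⟩
    take (length P) S
      ≡⟨ take-all (length P) S (≤-reflexive lenS) ⟩
    S ∎
    where
    open ≡-Reasoning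
    P = chainPositions h (length xs) j
    S = insertionSort (chainOf h xs j)
    lenS : length S ≡ length P
    lenS = ≡.trans (↭.↭-length (insertionSort-↭ (chainOf h xs j))) (length-map (at xs) P)
    entry : ∀ {i} → i ∈ P → at (pass h xs) i ≡ at S (length (chainPositions h i j))
    entry {i} i∈P with ∈-filter⁻ (λ i → h ∣? ∣ i - j ∣) {xs = upTo (length xs)} i∈P
    ... | i∈ , d = ≡.trans (at-map-upTo _ i (∈-upTo⁻ i∈))
                     (cong₂ (λ c k → at (insertionSort c) (length k))
                       (chainOf-cong h xs i j d) (chainPositions-cong h i i j d))

  -- The positions are the disjoint union of the `h` residue classes, each of which is a chain.
  -- Induction over the residues adds one chain at a time.
  chains-↭ : ∀ xs ys → length xs ≡ length ys → (∀ j → chainOf h xs j ↭ chainOf h ys j) → xs ↭ ys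
  chains-↭ xs ys len chain = begin
    xs                             ≡⟨ restrict xs ≡.refl ⟨
    map (at xs) (below h) ↭⟨ prefix h ≤-refl ⟩
    map (at ys) (below h) ≡⟨ restrict ys (sym len) ⟩
    ys ∎
    where
    open PermutationReasoning
    n = length xs
    below : ℕ → List ℕ
    below k = filter (λ i → i % h <? k) (upTo n)
    restrict : ∀ zs → length zs ≡ n → map (at zs) (below h) ≡ zs
    restrict zs eq = ≡.trans
      (cong (map (at zs)) (≡.trans (filter-all _ (All.tabulate (λ {i} _ → m%n<n i h))) (cong upTo (sym eq))))
      (map-at-upTo zs)
    split : ∀ k → below (suc k) ↭ below k ++ filter (λ i → i % h ≟ k) (upTo n)
    split k = filter-⊎ (λ i → i % h <? suc k) (λ i → i % h <? k) (λ i → i % h ≟ k) m<n⇒m<1+n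
      (λ eq → s≤s (≤-reflexive eq)) (λ lt → m≤n⇒m<n∨m≡n (≤-pred lt)) (λ lt eq → <⇒≢ lt eq) (upTo n)
    residue : ∀ {k} → k < h → filter (λ i → i % h ≟ k) (upTo n) ≡ chainPositions h n k
    residue {k} k<h = flip (filter-≐ _ _) (upTo n) (
      (λ {i} e → %≡⇒∣-∣ h i k (≡.trans e (sym (m<n⇒m%n≡m k<h)))) ,
      (λ {i} d → ≡.trans (∣-∣⇒%≡ h i k d) (m<n⇒m%n≡m k<h)))
    class : ∀ {k} → k < h → ∀ zs → length zs ≡ n →
            map (at zs) (filter (λ i → i % h ≟ k) (upTo n)) ≡ chainOf h zs k
    class {k} k<h zs eq = ≡.trans (cong (map (at zs)) (residue k<h))
      (cong (λ m → map (at zs) (chainPositions h m k)) (sym eq))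
    prefix : ∀ k → k ≤ h → map (at xs) (below k) ↭ map (at ys) (below k)
    prefix zero k≤h = ↭-reflexive (≡.trans (none xs) (sym (none ys)))
      where
      none : ∀ zs → map (at zs) (below 0) ≡ []
      none zs = cong (map (at zs)) (filter-none (λ i → i % h <? 0) (All.universal (λ _ ()) (upTo n)))
    prefix (suc k) k<h = begin
      map (at xs) (below (suc k))
        ↭⟨ ↭.map⁺ (at xs) (split k) ⟩
      map (at xs) (below k ++ filter (λ i → i % h ≟ k) (upTo n))
        ≡⟨ map-++ (at xs) (below k) _ ⟩
      map (at xs) (below k) ++ map (at xs) (filter (λ i → i % h ≟ k) (upTo n))
        ≡⟨ cong (map (at xs) (below k) ++_) (class k<h xs ≡.refl) ⟩
      map (at xs) (below k) ++ chainOf h xs k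
        ↭⟨ ↭.++⁺ (prefix k (<⇒≤ k<h)) (chain k) ⟩
      map (at ys) (below k) ++ chainOf h ys k
        ≡⟨ cong (map (at ys) (below k) ++_) (class k<h ys (sym len)) ⟨
      map (at ys) (below k) ++ map (at ys) (filter (λ i → i % h ≟ k) (upTo n))
        ≡⟨ map-++ (at ys) (below k) _ ⟨
      map (at ys) (below k ++ filter (λ i → i % h ≟ k) (upTo n))
        ↭⟨ ↭.map⁺ (at ys) (split k) ⟨
      map (at ys) (below (suc k)) ∎

  pass-↭ : ∀ xs → pass h xs ↭ xs
  pass-↭ xs = chains-↭ (pass h xs) xs (length-pass h xs) λ j →
    ↭-trans (↭-reflexive (chainOf-pass xs j)) (insertionSort-↭ (chainOf h xs j))

pass-1 : ∀ xs → pass 1 xs ≡ insertionSort xs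
pass-1 xs = ≡.trans (sym (whole (pass 1 xs))) (≡.trans (chainOf-pass 1 xs 0) (cong insertionSort (whole xs)))
  where
  whole : ∀ zs → chainOf 1 zs 0 ≡ zs
  whole zs = ≡.trans (cong (map (at zs)) (filter-all _ (All.tabulate λ _ → 1∣ _))) (map-at-upTo zs)

-- Inversion tables and the undoing of a pass

#larger : ℕ → List ℕ → ℕ
#larger x xs = length (filter (x <?_) xs)

-- Whatever exceeds `y` exceeds `x`, and `y` itself is counted only for `x`.
#larger-< : ∀ {x y} → x < y → ∀ zs → y ∈ zs → #larger y zs < #larger x zs
#larger-< {x} {y} x<y zs y∈zs = length-filter-< (y <?_) (x <?_) (<-trans x<y) y∈zs (<-irrefl ≡.refl) x<y

#larger-injective : ∀ {x y} zs → x ∈ zs → y ∈ zs → #larger x zs ≡ #larger y zs → x ≡ y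
#larger-injective {x} {y} zs x∈ y∈ eq with <-cmp x y
... | tri< x<y _ _ = contradiction (sym eq) (<⇒≢ (#larger-< x<y zs y∈))
... | tri≈ _ x≡y _ = x≡y
... | tri> _ _ y<x = contradiction eq (<⇒≢ (#larger-< y<x zs x∈))

#larger-∷ʳ : ∀ x xs → #larger x (xs ∷ʳ x) ≡ #larger x xs
#larger-∷ʳ x xs = begin
  length (filter (x <?_) (xs ∷ʳ x))  ≡⟨ cong length (filter-++ (x <?_) xs (x ∷ [])) ⟩
  length (filter (x <?_) xs ++ filter (x <?_) (x ∷ []))
    ≡⟨ cong (λ l → length (filter (x <?_) xs ++ l)) (filter-reject (x <?_) (<-irrefl ≡.refl)) ⟩
  length (filter (x <?_) xs ++ [])   ≡⟨ cong length (++-identityʳ (filter (x <?_) xs)) ⟩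
  length (filter (x <?_) xs) ∎
  where open ≡-Reasoning

-- The last element is the only one of the multiset with that many larger ones.
∷ʳ-↭-cancel : ∀ {x y : ℕ} xs ys → xs ∷ʳ x ↭ ys ∷ʳ y → #larger x xs ≡ #larger y ys → x ≡ y × xs ↭ ys
∷ʳ-↭-cancel {x} {y} xs ys e eq = x≡y , xs↭ys
  where
  x≡y : x ≡ y
  x≡y = #larger-injective (xs ∷ʳ x) (∈-++⁺ʳ xs (here ≡.refl))
    (↭.∈-resp-↭ (↭-sym e) (∈-++⁺ʳ ys (here ≡.refl)))
    (≡.trans (#larger-∷ʳ x xs) (≡.trans eq (≡.trans (sym (#larger-∷ʳ y ys))
      (sym (↭.↭-length (↭.filter-↭ (y <?_) e))))))
  xs↭ys : xs ↭ ys
  xs↭ys = ↭.drop-∷ (↭-trans (↭.∷↭∷ʳ x xs) (↭-trans e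
    (↭-trans (↭-sym (↭.∷↭∷ʳ y ys)) (↭-reflexive (cong (_∷ ys) (sym x≡y))))))

length-filter-map : ∀ {A B : Set} {P : Pred B ℓ₁} {Q : Pred A ℓ₂} (P? : Decidable P) (Q? : Decidable Q)
  (f : A → B) xs →
  length (filter (λ i → Q? i ×-dec P? (f i)) xs) ≡ length (filter P? (map f (filter Q? xs)))
length-filter-map P? Q? f [] = ≡.refl
length-filter-map P? Q? f (x ∷ xs) with Q? x
... | no _  = length-filter-map P? Q? f xs
... | yes _ with P? (f x)
...   | yes _ = cong suc (length-filter-map P? Q? f xs)
...   | no _  = length-filter-map P? Q? f xs

module _ (h : ℕ) .{{_ : NonZero h}} where

  -- Rewrites the count as one inside the part of the chain left of `m`, with any representative `r`
  -- of the chain, so that `∷ʳ-↭-cancel` can be applied.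
  mPos-#larger : ∀ xs r m → h ∣ ∣ m - r ∣ → mPos h xs m ≡ #larger (at xs m) (map (at xs) (chainPositions h m r))
  mPos-#larger xs r m d = ≡.trans
    (length-filter-map (at xs m <?_) (λ i → h ∣? ∣ i - m ∣) (at xs) (upTo m))
    (cong (#larger (at xs m) ∘ map (at xs)) (chainPositions-cong h m m r d))

  -- The chain is decoded from right to left. The count at its last position, together with the
  -- multiset of the prefix, fixes the entry there; removing it leaves the multiset of the shorter
  -- prefix.
  prefix-injective : ∀ xs ys r m → (∀ j → j < m → mPos h xs j ≡ mPos h ys j) →
    map (at xs) (chainPositions h m r) ↭ map (at ys) (chainPositions h m r) →
    ∀ j → j < m → h ∣ ∣ j - r ∣ → at xs j ≡ at ys j
  prefix-injective xs ys r (suc m) eqs e j j<1+m d with h ∣? ∣ m - r ∣ | m≤n⇒m<n∨m≡n (≤-pred j<1+m)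
  ... | no ¬dm | inj₂ ≡.refl = contradiction d ¬dm
  ... | no ¬dm | inj₁ j<m = prefix-injective xs ys r m (λ i i<m → eqs i (m<n⇒m<1+n i<m))
    (≡.subst (λ l → map (at xs) l ↭ map (at ys) l) (filter-upTo-reject (λ i → h ∣? ∣ i - r ∣) ¬dm) e) j j<m d
  ... | yes dm | side with ∷ʳ-↭-cancel (map (at xs) P) (map (at ys) P) e′ same
    where
    P = chainPositions h m r
    snoc : ∀ zs → map (at zs) (chainPositions h (suc m) r) ≡ map (at zs) P ∷ʳ at zs m
    snoc zs = ≡.trans (cong (map (at zs)) (filter-upTo-accept (λ i → h ∣? ∣ i - r ∣) dm))
      (map-++ (at zs) P (m ∷ []))
    e′ : map (at xs) P ∷ʳ at xs m ↭ map (at ys) P ∷ʳ at ys m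
    e′ = ↭-trans (↭-reflexive (sym (snoc xs))) (↭-trans e (↭-reflexive (snoc ys)))
    same : #larger (at xs m) (map (at xs) P) ≡ #larger (at ys m) (map (at ys) P)
    same = ≡.trans (sym (mPos-#larger xs r m dm)) (≡.trans (eqs m ≤-refl) (mPos-#larger ys r m dm))
  ...   | xm≡ym , _ with side
  ...     | inj₂ ≡.refl = xm≡ym
  prefix-injective xs ys r (suc m) eqs e j j<1+m d | yes dm | side | _ , e″ | inj₁ j<m =
    prefix-injective xs ys r m (λ i i<m → eqs i (m<n⇒m<1+n i<m)) e″ j j<m d

  -- A pass only permutes within chains, so equal outputs mean that every chain holds the same
  -- multiset in both inputs, and the counts then recover the order.
  pass-injective : ∀ xs ys → length xs ≡ length ys → pass h xs ≡ pass h ys →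
    (∀ j → j < length xs → mPos h xs j ≡ mPos h ys j) → xs ≡ ys
  pass-injective xs ys len passes eqs = at-ext xs ys len λ j j<n →
    prefix-injective xs ys j (length xs) eqs (chains j) j j<n (%≡⇒∣-∣ h j j ≡.refl)
    where
    open PermutationReasoning
    chains : ∀ j → map (at xs) (chainPositions h (length xs) j) ↭ map (at ys) (chainPositions h (length xs) j)
    chains j = begin
      chainOf h xs j                 ↭⟨ insertionSort-↭ (chainOf h xs j) ⟨
      insertionSort (chainOf h xs j) ≡⟨ chainOf-pass h xs j ⟨
      chainOf h (pass h xs) j        ≡⟨ cong (λ l → chainOf h l j) passes ⟩
      chainOf h (pass h ys) j        ≡⟨ chainOf-pass h ys j ⟩
      insertionSort (chainOf h ys j) ↭⟨ insertionSort-↭ (chainOf h ys j) ⟩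
      chainOf h ys j                 ≡⟨ cong (λ m → map (at ys) (chainPositions h m j)) len ⟨
      map (at ys) (chainPositions h (length xs) j) ∎

-- The code of a whole run

shellSort : List ℕ → List ℕ → List ℕ
shellSort []       xs = xs
shellSort (h ∷ hs) xs = shellSort hs (pass h xs)

movements : List ℕ → List ℕ → List ℕ
movements []       xs = []
movements (h ∷ hs) xs = map (mPos h xs) (upTo (length xs)) ++ movements hs (pass h xs)

length-mPos : ∀ h xs → length (map (mPos h xs) (upTo (length xs))) ≡ length xs
length-mPos h xs = ≡.trans (length-map _ (upTo (length xs))) (length-upTo (length xs))

length-movements : ∀ hs xs → length (movements hs xs) ≡ length hs * length xs
length-movements []       xs = ≡.refl
length-movements (h ∷ hs) xs = ≡.trans (length-++ (map (mPos h xs) (upTo (length xs))))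
  (cong₂ _+_ (length-mPos h xs)
    (≡.trans (length-movements hs (pass h xs)) (cong (length hs *_) (length-pass h xs))))

sum-movements : ∀ hs xs → sum (movements hs xs) ≡ shellInversions hs xs
sum-movements []       xs = ≡.refl
sum-movements (h ∷ hs) xs = ≡.trans (sum-++ (map (mPos h xs) (upTo (length xs))) _)
  (cong (passInversions h xs +_) (sum-movements hs (pass h xs)))

++-injective : ∀ {A : Set} (as bs : List A) {cs ds} → length as ≡ length bs →
  as ++ cs ≡ bs ++ ds → as ≡ bs × cs ≡ ds
++-injective []       []       _   eq = ≡.refl , eq
++-injective (a ∷ as) (b ∷ bs) len eq with ∷-injective eq
... | ≡.refl , eq′ with ++-injective as bs (suc-injective len) eq′
...   | ≡.refl , cs≡ds = ≡.refl , cs≡ds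

-- The blocks of the code have known lengths and can be cut apart. The later blocks determine the
-- list after the first pass by induction, and the first block undoes that pass.
movements-injective : ∀ hs → All (1 ≤_) hs → ∀ xs ys → length xs ≡ length ys →
  shellSort hs xs ≡ shellSort hs ys → movements hs xs ≡ movements hs ys → xs ≡ ys
movements-injective []       _            xs ys len sorted eq = sorted
movements-injective (h ∷ hs) (1≤h ∷ 1≤hs) xs ys len sorted eq
  with ++-injective (map (mPos h xs) (upTo (length xs))) (map (mPos h ys) (upTo (length ys)))
         (≡.trans (length-mPos h xs) (≡.trans len (sym (length-mPos h ys)))) eq
... | first , rest = pass-injective h {{>-nonZero 1≤h}} xs ys len
  (movements-injective hs 1≤hs (pass h xs) (pass h ys)
    (≡.trans (length-pass h xs) (≡.trans len (sym (length-pass h ys)))) sorted rest)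
  λ j j<n → ≡.trans (sym (at-map-upTo (mPos h xs) j j<n))
    (≡.trans (cong (λ l → at l j) first) (at-map-upTo (mPos h ys) j (≡.subst (j <_) len j<n)))

-- The earlier passes only rearrange the list, and the last one insertion sorts all of it, as its
-- only chain is the whole list.
shellSort-1 : ∀ hs → All (1 ≤_) hs → ∀ xs → shellSort (hs ++ 1 ∷ []) xs ≡ insertionSort xs
shellSort-1 []       _            xs = pass-1 xs
shellSort-1 (h ∷ hs) (1≤h ∷ 1≤hs) xs = ≡.trans (shellSort-1 hs 1≤hs (pass h xs))
  (insertionSort-cong-↭ (pass-↭ h {{>-nonZero 1≤h}} xs))

-- Counting lists of bounded sum

-- The empty case is a default value: `vectors` applies `increment` to lists of positive length
-- only.
increment : List ℕ → List ℕ
increment []       = []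
increment (x ∷ xs) = suc x ∷ xs

-- The lists of length d with sum at most K; the recursion is Pascal's rule for (K + d) C d.
vectors : ℕ → ℕ → List (List ℕ)
vectors zero    K       = [] ∷ []
vectors (suc d) zero    = map (0 ∷_) (vectors d zero)
vectors (suc d) (suc K) = map (0 ∷_) (vectors d (suc K)) ++ map increment (vectors (suc d) K)

∈-vectors : ∀ {d K} xs → length xs ≡ d → sum xs ≤ K → xs ∈ vectors d K
∈-vectors {zero}  {K}     []           _   _  = here ≡.refl
∈-vectors {suc d} {zero}  (zero ∷ xs)  len le = ∈-map⁺ (0 ∷_) (∈-vectors xs (suc-injective len) le)
∈-vectors {suc d} {suc K} (zero ∷ xs)  len le = ∈-++⁺ˡ (∈-map⁺ (0 ∷_) (∈-vectors xs (suc-injective len) le))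
∈-vectors {suc d} {suc K} (suc x ∷ xs) len le =
  ∈-++⁺ʳ (map (0 ∷_) (vectors d (suc K))) (∈-map⁺ increment (∈-vectors (x ∷ xs) len (≤-pred le)))

-- A single term of the binomial expansion of (u + w) ^ (K + d).
length-vectors : ∀ u w d K → length (vectors d K) * (u ^ K * w ^ d) ≤ (u + w) ^ (K + d)
length-vectors u w zero K = begin
  1 * (u ^ K * 1)   ≡⟨ ≡.trans (*-identityˡ _) (*-identityʳ _) ⟩
  u ^ K             ≤⟨ ^-monoˡ-≤ K (m≤m+n u w) ⟩
  (u + w) ^ K       ≡⟨ cong ((u + w) ^_) (+-identityʳ K) ⟨
  (u + w) ^ (K + 0) ∎
  where open ≤-Reasoning
length-vectors u w (suc d) zero = begin
  length (map (0 ∷_) (vectors d 0)) * (1 * (w * w ^ d))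
    ≡⟨ cong (_* (1 * (w * w ^ d))) (length-map _ (vectors d 0)) ⟩
  length (vectors d 0) * (1 * (w * w ^ d))
    ≡⟨ solve 3 (λ l w x → l :* (con 1 :* (w :* x)) := w :* (l :* (con 1 :* x)))
         ≡.refl (length (vectors d 0)) w (w ^ d) ⟩
  w * (length (vectors d 0) * (1 * w ^ d)) ≤⟨ *-mono-≤ (m≤n+m w u) (length-vectors u w d 0) ⟩
  (u + w) * (u + w) ^ d ∎
  where
  open ≤-Reasoning
  open +-*-Solver
length-vectors u w (suc d) (suc K) = begin
  length (map (0 ∷_) A ++ map increment B) * (u * u ^ K * (w * w ^ d))
    ≡⟨ cong (_* (u * u ^ K * (w * w ^ d)))
         (≡.trans (length-++ (map (0 ∷_) A)) (cong₂ _+_ (length-map _ A) (length-map _ B))) ⟩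
  (length A + length B) * (u * u ^ K * (w * w ^ d))
    ≡⟨ solve 6 (λ l m u x w y → (l :+ m) :* (u :* x :* (w :* y)) := u :* (m :* (x :* (w :* y))) :+ w :* (l :* (u :* x :* y)))
         ≡.refl (length A) (length B) u (u ^ K) w (w ^ d) ⟩
  -- Pascal's rule is matched with the expansion of one factor `u + w`: the lists in `B` take its
  -- `u`, those in `A` its `w`.
  u * (length B * (u ^ K * (w * w ^ d))) + w * (length A * (u * u ^ K * w ^ d))
    ≤⟨ +-mono-≤ (*-monoʳ-≤ u (length-vectors u w (suc d) K)) (*-monoʳ-≤ w (length-vectors u w d (suc K))) ⟩
  u * (u + w) ^ (K + suc d) + w * (u + w) ^ (suc K + d)
    ≡⟨ cong (λ e → u * (u + w) ^ (K + suc d) + w * (u + w) ^ e) (+-suc K d) ⟨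
  u * (u + w) ^ (K + suc d) + w * (u + w) ^ (K + suc d)
    ≡⟨ *-distribʳ-+ _ u w ⟨
  (u + w) * (u + w) ^ (K + suc d) ∎
  where
  open ≤-Reasoning
  open +-*-Solver
  A = vectors d (suc K)
  B = vectors (suc d) K

-- Duplicate-free lists and the enumeration of permutations

-- Pigeonhole: one occurrence of the head is cut out of `ys`; the tail avoids the head and so still
-- lies in what remains.
unique-⊆⇒length-≤ : ∀ {A : Set} {xs : List A} → Unique xs → ∀ ys →
                    (∀ {x} → x ∈ xs → x ∈ ys) → length xs ≤ length ys
unique-⊆⇒length-≤ []                _  _   = z≤n
unique-⊆⇒length-≤ {xs = x ∷ xs} (x∉ ∷ uniq) ys sub with ∈-∃++ (sub (here ≡.refl))
... | as , bs , ≡.refl = begin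
  suc (length xs)           ≤⟨ s≤s (unique-⊆⇒length-≤ uniq (as ++ bs) sub′) ⟩
  suc (length (as ++ bs))   ≡⟨ ↭.↭-length (↭.shift x as bs) ⟨
  length (as ++ x ∷ bs)     ∎
  where
  open ≤-Reasoning
  sub′ : ∀ {z} → z ∈ xs → z ∈ as ++ bs
  sub′ z∈ with ↭.∈-resp-↭ (↭.shift x as bs) (sub (there z∈))
  ... | here ≡.refl = contradiction ≡.refl (All.lookup x∉ z∈)
  ... | there z∈′   = z∈′

-- Injectivity is asked for on `xs` alone, since `movements` need not separate lists with different
-- entries.
unique-map : ∀ {A B : Set} (f : A → B) {xs} → (∀ {x y} → x ∈ xs → y ∈ xs → f x ≡ f y → x ≡ y) →
             Unique xs → Unique (map f xs)
unique-map f inj []          = []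
unique-map f inj (x∉ ∷ uniq) =
  All.map⁺ (All.tabulate λ y∈ eq → All.lookup x∉ y∈ (inj (here ≡.refl) (there y∈) eq)) ∷
  unique-map f (λ x∈ y∈ → inj (there x∈) (there y∈)) uniq

insertAll-↭ : ∀ x xs → All (_↭ x ∷ xs) (insertAll x xs)
insertAll-↭ x []       = ↭-refl ∷ []
insertAll-↭ x (y ∷ ys) = ↭-refl ∷
  All.map⁺ (All.map (λ e → ↭-trans (prep y e) (swap y x ↭-refl)) (insertAll-↭ x ys))

perms-↭ : ∀ xs → All (_↭ xs) (perms xs)
perms-↭ []       = ↭-refl ∷ []
perms-↭ (x ∷ xs) = All.concat⁺ (All.map⁺ (All.map
  (λ {ys} ys↭xs → All.map (λ e → ↭-trans e (prep x ys↭xs)) (insertAll-↭ x ys)) (perms-↭ xs)))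

length-insertAll : ∀ x xs → length (insertAll x xs) ≡ suc (length xs)
length-insertAll x []       = ≡.refl
length-insertAll x (y ∷ ys) = cong suc (≡.trans (length-map _ (insertAll x ys)) (length-insertAll x ys))

length-concatMap : ∀ {A B : Set} (f : A → List B) {c} xs → All (λ x → length (f x) ≡ c) xs →
                   length (concatMap f xs) ≡ length xs * c
length-concatMap f []       []         = ≡.refl
length-concatMap f (x ∷ xs) (eq ∷ eqs) = ≡.trans (length-++ (f x)) (cong₂ _+_ eq (length-concatMap f xs eqs))

length-perms : ∀ xs → length (perms xs) ≡ (length xs) !
length-perms []       = ≡.refl
length-perms (x ∷ xs) = begin
  length (concatMap (insertAll x) (perms xs))
    ≡⟨ length-concatMap (insertAll x) (perms xs)
         (All.map (λ {ys} e → ≡.trans (length-insertAll x ys) (cong suc (↭.↭-length e))) (perms-↭ xs)) ⟩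
  length (perms xs) * suc (length xs) ≡⟨ *-comm (length (perms xs)) (suc (length xs)) ⟩
  suc (length xs) * length (perms xs) ≡⟨ cong (suc (length xs) *_) (length-perms xs) ⟩
  suc (length xs) * (length xs) ! ∎
  where open ≡-Reasoning

delete : ℕ → List ℕ → List ℕ
delete x = filter (λ y → ¬? (x ≟ y))

delete-insertAll : ∀ x xs → All (λ ys → delete x ys ≡ delete x xs) (insertAll x xs)
delete-insertAll x []       = filter-reject (λ y → ¬? (x ≟ y)) {xs = []} (λ x≢x → x≢x ≡.refl) ∷ []
delete-insertAll x (y ∷ ys) =
  filter-reject (λ y → ¬? (x ≟ y)) {xs = y ∷ ys} (λ x≢x → x≢x ≡.refl) ∷
  All.map⁺ (All.map (λ {zs} → step {zs}) (delete-insertAll x ys))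
  where
  step : ∀ {zs} → delete x zs ≡ delete x ys → delete x (y ∷ zs) ≡ delete x (y ∷ ys)
  step {zs} eq = begin
    delete x (y ∷ zs)               ≡⟨ filter-++ (λ y → ¬? (x ≟ y)) (y ∷ []) zs ⟩
    delete x (y ∷ []) ++ delete x zs ≡⟨ cong (delete x (y ∷ []) ++_) eq ⟩
    delete x (y ∷ []) ++ delete x ys ≡⟨ filter-++ (λ y → ¬? (x ≟ y)) (y ∷ []) ys ⟨
    delete x (y ∷ ys)               ∎
    where open ≡-Reasoning

unique-insertAll : ∀ {x} xs → All (x ≢_) xs → Unique (insertAll x xs)
unique-insertAll     []       _            = [] ∷ []
unique-insertAll {x} (y ∷ ys) (x≢y ∷ x∉ys) =
  All.map⁺ (All.universal (λ zs eq → x≢y (∷-injectiveˡ eq)) (insertAll x ys)) ∷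
  Unique.map⁺ ∷-injectiveʳ (unique-insertAll ys x∉ys)

-- Lists made from the same shorter permutation differ in the place of `x`; lists made from
-- different ones are told apart by deleting `x`, which undoes the insertion.
unique-perms : ∀ {xs} → Unique xs → Unique (perms xs)
unique-perms []                     = [] ∷ []
unique-perms {x ∷ xs} (x∉xs ∷ uniq) =
  Unique.concat⁺ (All.map⁺ (All.map (λ {ys} → unique-insertAll ys) fresh)) (disjoint fresh (unique-perms uniq))
  where
  fresh : All (All (x ≢_)) (perms xs)
  fresh = All.map (λ e → ↭.All-resp-↭ (↭-sym e) x∉xs) (perms-↭ xs)
  delete-fresh : ∀ {ys zs} → All (x ≢_) ys → zs ∈ insertAll x ys → delete x zs ≡ ys
  delete-fresh {ys} x∉ys zs∈ = ≡.trans (All.lookup (delete-insertAll x ys) zs∈) (filter-all _ x∉ys)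
  apart : ∀ {ys zs} → All (x ≢_) ys → All (x ≢_) zs → ys ≢ zs → Disjoint (insertAll x ys) (insertAll x zs)
  apart x∉ys x∉zs ys≢zs (v∈ , v∈′) =
    ys≢zs (≡.trans (sym (delete-fresh x∉ys v∈)) (delete-fresh x∉zs v∈′))
  disjoint : ∀ {yss} → All (All (x ≢_)) yss → Unique yss → AllPairs Disjoint (map (insertAll x) yss)
  disjoint []           []           = []
  disjoint (x∉ys ∷ x∉s) (ys∉ ∷ uniq) =
    All.map⁺ (All.tabulate λ zs∈ → apart x∉ys (All.lookup x∉s zs∈) (All.lookup ys∉ zs∈)) ∷
    disjoint x∉s uniq

-- From few fast permutations to a large average

-- Markov's inequality free of subtraction: an element with value above `K` pays its `suc K` out of
-- the sum, any other out of the count on the right.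
markov : ∀ {A : Set} (f : A → ℕ) K xs →
         suc K * length xs ≤ sum (map f xs) + suc K * length (filter (λ x → f x ≤? K) xs)
markov f K []       = ≤-refl
markov f K (x ∷ xs) with ≤-<-connex (f x) K
... | inj₁ fx≤K = begin
  suc K * suc (length xs)                ≡⟨ *-suc (suc K) (length xs) ⟩
  suc K + suc K * length xs              ≤⟨ +-monoʳ-≤ (suc K) (markov f K xs) ⟩
  suc K + (sum (map f xs) + suc K * l)   ≤⟨ m≤n+m _ (f x) ⟩
  f x + (suc K + (sum (map f xs) + suc K * l))
    ≡⟨ solve 4 (λ a k s l → a :+ (k :+ (s :+ k :* l)) := a :+ s :+ (k :* (con 1 :+ l)))
         ≡.refl (f x) (suc K) (sum (map f xs)) l ⟩
  f x + sum (map f xs) + suc K * suc l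
    ≡⟨ cong (λ ys → f x + sum (map f xs) + suc K * length ys) (filter-accept (λ x → f x ≤? K) fx≤K) ⟨
  sum (map f (x ∷ xs)) + suc K * length (filter (λ x → f x ≤? K) (x ∷ xs)) ∎
  where
  open ≤-Reasoning
  open +-*-Solver
  l = length (filter (λ x → f x ≤? K) xs)
... | inj₂ K<fx = begin
  suc K * suc (length xs)                ≡⟨ *-suc (suc K) (length xs) ⟩
  suc K + suc K * length xs              ≤⟨ +-mono-≤ K<fx (markov f K xs) ⟩
  f x + (sum (map f xs) + suc K * l)     ≡⟨ +-assoc (f x) _ _ ⟨
  f x + sum (map f xs) + suc K * l
    ≡⟨ cong (λ ys → f x + sum (map f xs) + suc K * length ys) (filter-reject (λ x → f x ≤? K) (<⇒≱ K<fx)) ⟨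
  sum (map f (x ∷ xs)) + suc K * length (filter (λ x → f x ≤? K) (x ∷ xs)) ∎
  where
  open ≤-Reasoning
  l = length (filter (λ x → f x ≤? K) xs)

few-fast-permutations : ∀ n hs → All (1 ≤_) hs → ∀ K →
  length (filter (λ xs → shellInversions (hs ++ 1 ∷ []) xs ≤? K) (permutationsOf n))
    ≤ length (vectors (length (hs ++ 1 ∷ []) * n) K)
few-fast-permutations n hs 1≤hs K = begin
  length fast                        ≡⟨ length-map (movements hs₁) fast ⟨
  length (map (movements hs₁) fast)
    ≤⟨ unique-⊆⇒length-≤ (unique-map (movements hs₁) injective uniq) _ covered ⟩
  length (vectors (length hs₁ * n) K) ∎
  where
  open ≤-Reasoning
  hs₁ = hs ++ 1 ∷ []
  identity = map suc (upTo n)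
  fast = filter (λ xs → shellInversions hs₁ xs ≤? K) (permutationsOf n)
  uniq : Unique fast
  uniq = Unique.filter⁺ _ (unique-perms (Unique.map⁺ suc-injective (Unique.upTo⁺ n)))
  fast-↭ : ∀ {xs} → xs ∈ fast → xs ↭ identity
  fast-↭ xs∈ = All.lookup (perms-↭ identity)
    (proj₁ (∈-filter⁻ (λ xs → shellInversions hs₁ xs ≤? K) {xs = permutationsOf n} xs∈))
  injective : ∀ {xs ys} → xs ∈ fast → ys ∈ fast → movements hs₁ xs ≡ movements hs₁ ys → xs ≡ ys
  injective {xs} {ys} xs∈ ys∈ = movements-injective hs₁ (All.++⁺ 1≤hs (s≤s z≤n ∷ [])) xs ys
    (↭.↭-length xs↭ys)
    -- Both runs end in the same list, because both inputs rearrange `identity`.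
    (≡.trans (shellSort-1 hs 1≤hs xs) (≡.trans (insertionSort-cong-↭ xs↭ys) (sym (shellSort-1 hs 1≤hs ys))))
    where
    xs↭ys : xs ↭ ys
    xs↭ys = ↭-trans (fast-↭ xs∈) (↭-sym (fast-↭ ys∈))
  covered : ∀ {v} → v ∈ map (movements hs₁) fast → v ∈ vectors (length hs₁ * n) K
  covered v∈ with ∈-map⁻ (movements hs₁) v∈
  ... | xs , xs∈ , ≡.refl = ∈-vectors (movements hs₁ xs)
    (≡.trans (length-movements hs₁ xs) (cong (length hs₁ *_)
      (≡.trans (↭.↭-length (fast-↭ xs∈)) (≡.trans (length-map suc (upTo n)) (length-upTo n)))))
    (≤-trans (≤-reflexive (sum-movements hs₁ xs))
      (proj₂ (∈-filter⁻ (λ xs → shellInversions hs₁ xs ≤? K) {xs = permutationsOf n} xs∈)))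

-- At least half of the permutations exceed `K` and contribute `suc K` or more each. Adding
-- `suc K * n !` to both sides takes the place of subtracting the fast half.
totalInversions-≥ : ∀ n hs → All (1 ≤_) hs → ∀ K → 2 * length (vectors (length (hs ++ 1 ∷ []) * n) K) ≤ n ! →
  suc K * n ! ≤ 2 * totalInversions (hs ++ 1 ∷ []) n
totalInversions-≥ n hs 1≤hs K few = +-cancelʳ-≤ (suc K * n !) _ _ (begin
  suc K * n ! + suc K * n !         ≡⟨ cong (suc K * n ! +_) (+-identityʳ _) ⟨
  2 * (suc K * n !)                 ≡⟨ cong (λ l → 2 * (suc K * l)) length-all ⟨
  2 * (suc K * length all)          ≤⟨ *-monoʳ-≤ 2 (markov (shellInversions hs₁) K all) ⟩
  2 * (T + suc K * l)
    ≡⟨ solve 3 (λ t k l → con 2 :* (t :+ k :* l) := con 2 :* t :+ k :* (con 2 :* l)) ≡.refl T (suc K) l ⟩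
  2 * T + suc K * (2 * l)
    ≤⟨ +-monoʳ-≤ (2 * T) (*-monoʳ-≤ (suc K) (≤-trans (*-monoʳ-≤ 2 (few-fast-permutations n hs 1≤hs K)) few)) ⟩
  2 * T + suc K * n !               ∎)
  where
  open ≤-Reasoning
  open +-*-Solver
  hs₁ = hs ++ 1 ∷ []
  all = permutationsOf n
  T = totalInversions hs₁ n
  l = length (filter (λ xs → shellInversions hs₁ xs ≤? K) all)
  length-all : length all ≡ n !
  length-all = ≡.trans (length-perms (map suc (upTo n)))
    (cong _! (≡.trans (length-map suc (upTo n)) (length-upTo n)))

-- Inequalities for powers and the factorial

^-distribʳ-* : ∀ k m n → (m * n) ^ k ≡ m ^ k * n ^ k
^-distribʳ-* zero    m n = ≡.refl
^-distribʳ-* (suc k) m n = ≡.trans (cong (m * n *_) (^-distribʳ-* k m n))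
  ([m*n]*[o*p]≡[m*o]*[n*p] m n (m ^ k) (n ^ k))

^-cancelˡ-≤ : ∀ k .{{_ : NonZero k}} {m n} → m ^ k ≤ n ^ k → m ≤ n
^-cancelˡ-≤ k le = ≮⇒≥ λ n<m → <⇒≱ (^-monoˡ-< k n<m) le

-- Bernoulli's inequality (1 - 1/(a+1))^m >= 1 - m/(a+1), cleared of fractions and subtraction.
bernoulli : ∀ a m → suc a * suc a ^ m ≤ suc a * a ^ m + m * suc a ^ m
bernoulli a zero    = ≤-reflexive (sym (+-identityʳ _))
bernoulli a (suc m) = begin
  suc a * (suc a * B)                               ≡⟨⟩
  suc a * B + a * (suc a * B)
    ≤⟨ +-monoʳ-≤ (suc a * B) (*-monoʳ-≤ a (bernoulli a m)) ⟩
  suc a * B + a * (suc a * a ^ m + m * B)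
    ≤⟨ +-monoʳ-≤ (suc a * B) (≤-trans (≤-reflexive (*-distribˡ-+ a (suc a * a ^ m) (m * B)))
         (+-monoʳ-≤ (a * (suc a * a ^ m)) (*-monoˡ-≤ (m * B) (n≤1+n a)))) ⟩
  suc a * B + (a * (suc a * a ^ m) + suc a * (m * B))
    ≡⟨ solve 5 (λ s a b m x → s :* b :+ (a :* (s :* x) :+ s :* (m :* b)) := s :* (a :* x) :+ (con 1 :+ m) :* (s :* b))
         ≡.refl (suc a) a B m (a ^ m) ⟩
  suc a * (a * a ^ m) + suc m * (suc a * B)         ∎
  where
  open ≤-Reasoning
  open +-*-Solver
  B = suc a ^ m

-- For m up to (a+1)/2 the lower bound in Bernoulli's inequality is at least 1/2.
[1+a]^m≤2*a^m : ∀ a m → m + m ≤ suc a → suc a ^ m ≤ 2 * a ^ m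
[1+a]^m≤2*a^m a m 2m≤1+a = *-cancelˡ-≤ (suc a) (+-cancelʳ-≤ (suc a * B) _ _ (begin
  suc a * B + suc a * B
    ≤⟨ +-mono-≤ (bernoulli a m) (bernoulli a m) ⟩
  suc a * a ^ m + m * B + (suc a * a ^ m + m * B)
    ≡⟨ solve 4 (λ s x m b → s :* x :+ m :* b :+ (s :* x :+ m :* b) := s :* (con 2 :* x) :+ (m :+ m) :* b)
         ≡.refl (suc a) (a ^ m) m B ⟩
  suc a * (2 * a ^ m) + (m + m) * B
    ≤⟨ +-monoʳ-≤ (suc a * (2 * a ^ m)) (*-monoˡ-≤ B 2m≤1+a) ⟩
  suc a * (2 * a ^ m) + suc a * B                                 ∎))
  where
  open ≤-Reasoning
  open +-*-Solver
  B = suc a ^ m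

-- A crude form of (1 + 1/n)^n <= e: each half of the exponent is at most (n+1)/2 and costs a factor
-- 2.
[1+n]^n≤4*n^n : ∀ n → suc n ^ n ≤ 4 * n ^ n
[1+n]^n≤4*n^n n = begin
  suc n ^ n                       ≡⟨ cong (suc n ^_) split ⟨
  suc n ^ (l + u)                 ≡⟨ ^-distribˡ-+-* (suc n) l u ⟩
  suc n ^ l * suc n ^ u           ≤⟨ *-mono-≤ ([1+a]^m≤2*a^m n l l+l≤) ([1+a]^m≤2*a^m n u u+u≤) ⟩
  2 * n ^ l * (2 * n ^ u)         ≡⟨ [m*n]*[o*p]≡[m*o]*[n*p] 2 (n ^ l) 2 (n ^ u) ⟩
  4 * (n ^ l * n ^ u)             ≡⟨ cong (4 *_) (^-distribˡ-+-* n l u) ⟨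
  4 * n ^ (l + u)                 ≡⟨ cong (λ e → 4 * n ^ e) split ⟩
  4 * n ^ n                       ∎
  where
  open ≤-Reasoning
  l = ⌊ n /2⌋
  u = ⌈ n /2⌉
  split : l + u ≡ n
  split = ⌊n/2⌋+⌈n/2⌉≡n n
  l+l≤ : l + l ≤ suc n
  l+l≤ = m≤n⇒m≤1+n (≤-trans (+-monoʳ-≤ l (⌊n/2⌋≤⌈n/2⌉ n)) (≤-reflexive split))
  u+u≤ : u + u ≤ suc n
  u+u≤ = ≤-trans (+-monoʳ-≤ u (⌊n/2⌋≤⌈n/2⌉ (suc n))) (≤-reflexive (⌊n/2⌋+⌈n/2⌉≡n (suc n)))

-- Stirling's lower bound for the factorial with 4 in place of e, by induction on the ratio of
-- successive terms.
n^n≤4^n*n! : ∀ n → n ^ n ≤ 4 ^ n * n !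
n^n≤4^n*n! zero    = s≤s z≤n
n^n≤4^n*n! (suc n) = begin
  suc n * suc n ^ n             ≤⟨ *-monoʳ-≤ (suc n) ([1+n]^n≤4*n^n n) ⟩
  suc n * (4 * n ^ n)           ≤⟨ *-monoʳ-≤ (suc n) (*-monoʳ-≤ 4 (n^n≤4^n*n! n)) ⟩
  suc n * (4 * (4 ^ n * n !))
    ≡⟨ solve 3 (λ s x f → s :* (con 4 :* (x :* f)) := con 4 :* x :* (s :* f))
         ≡.refl (suc n) (4 ^ n) (n !) ⟩
  4 ^ suc n * (suc n) !         ∎
  where
  open ≤-Reasoning
  open +-*-Solver

-- The number of codes against the factorial

-- The binomial bound with weights `u` = 2r - 1 and 1, whose sum is 2r. Replacing `u` by 2r costs at
-- most a factor 2 for each `r` of the `r * d` powers, so 2^d in all; the other `d` powers of 2r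
-- complete (4r)^d.
length-vectors-≤ : ∀ r .{{_ : NonZero r}} d → length (vectors d (r * d)) ≤ (4 * r) ^ d
length-vectors-≤ r@(suc r′) d = *-cancelʳ-≤ _ _ (u ^ K) {{m^n≢0 u K}} (begin
  L * u ^ K
    ≡⟨ cong (L *_) (≡.trans (cong (u ^ K *_) (^-zeroˡ d)) (*-identityʳ _)) ⟨
  L * (u ^ K * 1 ^ d)             ≤⟨ length-vectors u 1 d K ⟩
  (u + 1) ^ (K + d)               ≡⟨ cong (_^ (K + d)) (+-comm u 1) ⟩
  suc u ^ (K + d)                 ≡⟨ ^-distribˡ-+-* (suc u) K d ⟩
  suc u ^ K * suc u ^ d           ≡⟨ cong (_* suc u ^ d) (^-*-assoc (suc u) r d) ⟨
  (suc u ^ r) ^ d * suc u ^ d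
    ≤⟨ *-monoˡ-≤ (suc u ^ d) (^-monoˡ-≤ d ([1+a]^m≤2*a^m u r (≤-reflexive (solve 1 (λ r → con 1 :+ r :+ (con 1 :+ r) := con 1 :+ (con 1 :+ (r :+ r)))
         ≡.refl r′)))) ⟩
  (2 * u ^ r) ^ d * suc u ^ d     ≡⟨ cong (_* suc u ^ d) (^-distribʳ-* d 2 (u ^ r)) ⟩
  2 ^ d * (u ^ r) ^ d * suc u ^ d ≡⟨ cong (λ x → 2 ^ d * x * suc u ^ d) (^-*-assoc u r d) ⟩
  2 ^ d * u ^ K * suc u ^ d
    ≡⟨ solve 3 (λ x y z → x :* y :* z := x :* z :* y) ≡.refl (2 ^ d) (u ^ K) (suc u ^ d) ⟩
  2 ^ d * suc u ^ d * u ^ K       ≡⟨ cong (_* u ^ K) (^-distribʳ-* d 2 (suc u)) ⟨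
  (2 * suc u) ^ d * u ^ K
    ≡⟨ cong (λ x → x ^ d * u ^ K) (solve 1 (λ r → con 2 :* (con 1 :+ (con 1 :+ (r :+ r))) := con 4 :* (con 1 :+ r))
         ≡.refl r′) ⟩
  (4 * r) ^ d * u ^ K             ∎)
  where
  open ≤-Reasoning
  open +-*-Solver
  u = suc (r′ + r′)
  K = r * d
  L = length (vectors d K)

-- The constant 32 is 4 * 2 * 4: the 4 of the factorial bound, the 2 for one half, and the 4 in
-- `length-vectors-≤`. The first two occur to the power `n`, which is at most `p * n`.
few-vectors-large : ∀ n p r → 1 ≤ n → 1 ≤ p → 1 ≤ r → (32 * r) ^ p ≤ n →
  2 * length (vectors (p * n) (r * (p * n))) ≤ n !
few-vectors-large n p r 1≤n 1≤p 1≤r le = *-cancelˡ-≤ (4 ^ n) {{m^n≢0 4 n}} (begin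
  4 ^ n * (2 * L)
    ≤⟨ *-monoʳ-≤ (4 ^ n) (*-mono-≤ (^-monoʳ-≤ 2 1≤n) (length-vectors-≤ r {{>-nonZero 1≤r}} d)) ⟩
  4 ^ n * (2 ^ n * (4 * r) ^ d)  ≡⟨ *-assoc (4 ^ n) (2 ^ n) _ ⟨
  4 ^ n * 2 ^ n * (4 * r) ^ d    ≡⟨ cong (_* (4 * r) ^ d) (^-distribʳ-* n 4 2) ⟨
  8 ^ n * (4 * r) ^ d
    ≤⟨ *-monoˡ-≤ ((4 * r) ^ d) (^-monoʳ-≤ 8 (m≤n*m n p {{>-nonZero 1≤p}})) ⟩
  8 ^ d * (4 * r) ^ d            ≡⟨ ^-distribʳ-* d 8 (4 * r) ⟨
  (8 * (4 * r)) ^ d              ≡⟨ cong (_^ d) (*-assoc 8 4 r) ⟨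
  (32 * r) ^ (p * n)             ≡⟨ ^-*-assoc (32 * r) p n ⟨
  ((32 * r) ^ p) ^ n             ≤⟨ ^-monoˡ-≤ n le ⟩
  n ^ n                          ≤⟨ n^n≤4^n*n! n ⟩
  4 ^ n * n !                    ∎)
  where
  open ≤-Reasoning
  d = p * n
  L = length (vectors d (r * d))

-- The binomial bound with weights 1 and 3. Fourth powers make the exponents integral: 4^(4(K+d)) is
-- at most 2^(9d) = 512^d, and 512 <= 8 * 81 with 81 = 3^4. So the count is at most 2^(3d/4), with
-- an exponent safely below `d`.
length-vectors-/8 : ∀ d → length (vectors d (d / 8)) ^ 4 ≤ 8 ^ d
length-vectors-/8 d = *-cancelʳ-≤ _ _ (81 ^ d) {{m^n≢0 81 d}} (begin
  L ^ 4 * 81 ^ d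
    ≡⟨ cong (L ^ 4 *_) (≡.trans (^-*-assoc 3 4 d) (≡.trans (cong (3 ^_) (*-comm 4 d)) (sym (^-*-assoc 3 d 4)))) ⟩
  L ^ 4 * (3 ^ d) ^ 4       ≡⟨ ^-distribʳ-* 4 L (3 ^ d) ⟨
  (L * 3 ^ d) ^ 4
    ≡⟨ cong (λ x → (L * x) ^ 4) (≡.trans (cong (_* 3 ^ d) (^-zeroˡ K)) (*-identityˡ _)) ⟨
  (L * (1 ^ K * 3 ^ d)) ^ 4 ≤⟨ ^-monoˡ-≤ 4 (length-vectors 1 3 d K) ⟩
  (4 ^ (K + d)) ^ 4         ≡⟨ ^-*-assoc 4 (K + d) 4 ⟩
  4 ^ ((K + d) * 4)         ≡⟨ ^-*-assoc 2 2 ((K + d) * 4) ⟩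
  2 ^ (2 * ((K + d) * 4))
    ≡⟨ cong (2 ^_) (solve 2 (λ k d → con 2 :* ((k :+ d) :* con 4) := k :* con 8 :+ con 8 :* d)
         ≡.refl K d) ⟩
  2 ^ (K * 8 + 8 * d)       ≤⟨ ^-monoʳ-≤ 2 (+-monoˡ-≤ (8 * d) (m/n*n≤m d 8)) ⟩
  2 ^ (9 * d)               ≡⟨ ^-*-assoc 2 9 d ⟨
  512 ^ d                   ≤⟨ ^-monoˡ-≤ d (≤ᵇ⇒≤ 512 648 _) ⟩
  (8 * 81) ^ d              ≡⟨ ^-distribʳ-* d 8 81 ⟩
  8 ^ d * 81 ^ d            ∎)
  where
  open ≤-Reasoning
  open +-*-Solver
  K = d / 8
  L = length (vectors d K)

-- With 2^p <= n the count is at most n^(3n/4). The remaining n^(n/4) must absorb the 4^n of the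
-- factorial bound and the factor 2; in fourth powers this asks for n >= 4^4 * 2^4 = 4096.
few-vectors-small : ∀ n p → 4096 ≤ n → 2 ^ p ≤ n → 2 * length (vectors (p * n) ((p * n) / 8)) ≤ n !
few-vectors-small n p 4096≤n 2^p≤n = ^-cancelˡ-≤ 4 (*-cancelˡ-≤ (256 ^ n) {{m^n≢0 256 n}} (begin
  256 ^ n * (2 * L) ^ 4           ≡⟨ cong (256 ^ n *_) (^-distribʳ-* 4 2 L) ⟩
  256 ^ n * (16 * L ^ 4)
    ≤⟨ *-monoʳ-≤ (256 ^ n) (*-mono-≤ (^-monoʳ-≤ 16 {1} {n} (≤-trans (s≤s z≤n) 4096≤n)) (length-vectors-/8 d)) ⟩
  256 ^ n * (16 ^ n * 8 ^ d)      ≡⟨ *-assoc (256 ^ n) (16 ^ n) (8 ^ d) ⟨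
  256 ^ n * 16 ^ n * 8 ^ d        ≡⟨ cong (_* 8 ^ d) (^-distribʳ-* n 256 16) ⟨
  4096 ^ n * 8 ^ d                ≤⟨ *-mono-≤ (^-monoˡ-≤ n 4096≤n) 8^d≤ ⟩
  (n ^ n) ^ 4                     ≤⟨ ^-monoˡ-≤ 4 (n^n≤4^n*n! n) ⟩
  (4 ^ n * n !) ^ 4               ≡⟨ ^-distribʳ-* 4 (4 ^ n) (n !) ⟩
  (4 ^ n) ^ 4 * (n !) ^ 4
    ≡⟨ cong (_* (n !) ^ 4) (≡.trans (^-*-assoc 4 n 4) (≡.trans (cong (4 ^_) (*-comm n 4)) (sym (^-*-assoc 4 4 n)))) ⟩
  256 ^ n * (n !) ^ 4             ∎))
  where
  open ≤-Reasoning
  d = p * n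
  L = length (vectors d (d / 8))
  8^d≤ : 8 ^ d ≤ (n ^ n) ^ 3
  8^d≤ = begin
    8 ^ d
      ≡⟨ ≡.trans (^-*-assoc 2 3 d) (≡.trans (cong (2 ^_) (*-comm 3 d)) (sym (^-*-assoc 2 d 3))) ⟩
    (2 ^ (p * n)) ^ 3 ≡⟨ cong (_^ 3) (^-*-assoc 2 p n) ⟨
    ((2 ^ p) ^ n) ^ 3 ≤⟨ ^-monoˡ-≤ 3 (^-monoˡ-≤ n 2^p≤n) ⟩
    (n ^ n) ^ 3     ∎

-- The integer root and the choice of the threshold

last-true : ∀ {ℓ} {P : Pred ℕ ℓ} → Decidable P → ∀ {k} m → P k → ¬ P (m + k) →
            Σ ℕ λ r → k ≤ r × P r × ¬ P (suc r)
last-true P? zero    pk ¬p = contradiction pk ¬p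
last-true {P = P} P? {k} (suc m) pk ¬p with P? (suc k)
... | no ¬psk = k , ≤-refl , pk , ¬psk
... | yes psk with last-true P? m psk (λ q → ¬p (subst P (+-suc m k) q))
...   | r , k<r , pr , ¬psr = r , <⇒≤ k<r , pr , ¬psr

-- Here `r` is the integer part of n^(1/p) / 32. Rounding down loses at most a factor 2, because
-- `suc r` is at most `r + r` once `r` is positive.
scaled-root : ∀ n p → 1 ≤ p → 32 ^ p ≤ n → Σ ℕ λ r → 1 ≤ r × (32 * r) ^ p ≤ n × n ≤ (64 * r) ^ p
scaled-root n p 1≤p le with last-true (λ r → (32 * r) ^ p ≤? n) {1} n le
  -- The search from 1 may stop at `n + 1`, where the power already exceeds `n`.
  (<⇒≱ (begin-strict
    n                      <⟨ n<1+n n ⟩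
    suc n                  ≡⟨ +-comm 1 n ⟩
    n + 1                  ≤⟨ m≤n*m (n + 1) 32 ⟩
    32 * (n + 1)           ≡⟨ ^-identityʳ (32 * (n + 1)) ⟨
    (32 * (n + 1)) ^ 1
      ≤⟨ ^-monoʳ-≤ (32 * (n + 1)) {{>-nonZero (≤-trans (m≤n+m 1 n) (m≤n*m (n + 1) 32))}} 1≤p ⟩
    (32 * (n + 1)) ^ p     ∎))
  where open ≤-Reasoning
... | r , 1≤r , pr , ¬psr = r , 1≤r , pr , (begin
  n                     ≤⟨ <⇒≤ (≰⇒> ¬psr) ⟩
  (32 * suc r) ^ p      ≤⟨ ^-monoˡ-≤ p (*-monoʳ-≤ 32 (+-monoˡ-≤ r 1≤r)) ⟩
  (32 * (r + r)) ^ p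
    ≡⟨ cong (_^ p) (solve 1 (λ r → con 32 :* (r :+ r) := con 64 :* r) ≡.refl r) ⟩
  (64 * r) ^ p          ∎)
  where
  open ≤-Reasoning
  open +-*-Solver

n≤8*[1+n/8] : ∀ d → d ≤ 8 * suc (d / 8)
n≤8*[1+n/8] d = begin
  d                   ≡⟨ m≡m%n+[m/n]*n d 8 ⟩
  d % 8 + d / 8 * 8   ≤⟨ +-monoˡ-≤ (d / 8 * 8) (<⇒≤ (m%n<n d 8)) ⟩
  suc (d / 8) * 8     ≡⟨ *-comm (suc (d / 8)) 8 ⟩
  8 * suc (d / 8)     ∎
  where open ≤-Reasoning

-- Here `s` is an upper bound for n^(1/p); working with p-th powers avoids real roots.
root-bound : ∀ p t {x n s} → n ≤ s ^ p → x * s ≤ t → x ^ p * n ≤ t ^ p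
root-bound p t {x} {n} {s} n≤s^p le = begin
  x ^ p * n        ≤⟨ *-monoʳ-≤ (x ^ p) n≤s^p ⟩
  x ^ p * s ^ p    ≡⟨ ^-distribʳ-* p x s ⟨
  (x * s) ^ p      ≤⟨ ^-monoˡ-≤ p le ⟩
  t ^ p            ∎
  where open ≤-Reasoning

-- Collects the constants: `a` compares `x` with the threshold `k`, `b` is the 2 of
-- `totalInversions-≥`, and `c` belongs to the bound on the root.
rescale : ∀ a b c t {x k y} → x ≤ a * k → k * y ≤ b * t → x * y * c ≤ a * b * c * t
rescale a b c t {x} {k} {y} x≤ak ky≤bt = begin
  x * y * c         ≤⟨ *-monoˡ-≤ c (*-monoˡ-≤ y x≤ak) ⟩
  a * k * y * c     ≡⟨ cong (_* c) (*-assoc a k y) ⟩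
  a * (k * y) * c   ≤⟨ *-monoˡ-≤ c (*-monoʳ-≤ a ky≤bt) ⟩
  a * (b * t) * c   ≡⟨ solve 4 (λ a b c t → a :* (b :* t) :* c := a :* b :* c :* t) ≡.refl a b c t ⟩
  a * b * c * t     ∎
  where
  open ≤-Reasoning
  open +-*-Solver

module _ (n : ℕ) (4096≤n : 4096 ≤ n) (hs : List ℕ) (1≤hs : All (1 ≤_) hs) where

  private
    p = length (hs ++ 1 ∷ [])
    T = totalInversions (hs ++ 1 ∷ []) n

  -- The root of `n` is below 32, so a threshold linear in `p * n` has the right order. The constant
  -- is 512 = 8 * 2 * 32, with 8 from the rounded quotient `p * n / 8`.
  bound-small : 2 ^ p ≤ n → n < 32 ^ p → (p * n * n !) ^ p * n ≤ (512 * T) ^ p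
  bound-small 2^p≤n n<32^p = root-bound p (512 * T) (<⇒≤ n<32^p)
    (rescale 8 2 32 T (n≤8*[1+n/8] (p * n))
      (totalInversions-≥ n hs 1≤hs (p * n / 8) (few-vectors-small n p 4096≤n 2^p≤n)))

  bound-large : 1 ≤ p → 32 ^ p ≤ n → (p * n * n !) ^ p * n ≤ (512 * T) ^ p
  bound-large 1≤p 32^p≤n = let r , 1≤r , below , above = scaled-root n p 1≤p 32^p≤n in
    root-bound p (512 * T) above (begin
      p * n * n ! * (64 * r)   ≡⟨ reorder (p * n) (n !) 64 r ⟩
      r * (p * n) * n ! * 64
        -- The threshold is `r * (p * n)`, and 64r bounds the root from above; hence the constant 2
        -- * 64 = 128, which is then weakened to the 512 of the other case.
        ≤⟨ rescale 1 2 64 T (≤-trans (n≤1+n (r * (p * n))) (≤-reflexive (sym (*-identityˡ _))))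
                                   (totalInversions-≥ n hs 1≤hs (r * (p * n))
                                     (few-vectors-large n p r (≤-trans (s≤s z≤n) 4096≤n) 1≤p 1≤r below)) ⟩
      128 * T                  ≤⟨ *-monoˡ-≤ T {128} {512} (≤ᵇ⇒≤ 128 512 _) ⟩
      512 * T                  ∎)
    where
    open ≤-Reasoning
    open +-*-Solver
    reorder : ∀ d f c r → d * f * (c * r) ≡ r * d * f * c
    reorder = solve 4 (λ d f c r → d :* f :* (c :* r) := r :* d :* f :* c) ≡.refl

theorem1 : Σ ℕ λ a → Σ ℕ λ b → 0 < a × 0 < b × Σ ℕ λ N →
    (n : ℕ) → N ≤ n → (p : ℕ) → 1 ≤ p → 2 ^ p ≤ n →
    (hs : List ℕ) → length hs ≡ p → All (1 ≤_) hs →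
    Σ (List ℕ) (λ hs′ → hs ≡ hs′ ++ (1 ∷ [])) →
    (a * p * n * (n !)) ^ p * n ≤ (b * totalInversions hs n) ^ p
-- The constant is c = 1/512. The expectation is `totalInversions` divided by `n !`, and both sides
-- are raised to the power `p`.
theorem1 = 1 , 512 , s≤s z≤n , s≤s z≤n , 4096 , bound
  where
  bound : ∀ n → 4096 ≤ n → ∀ p → 1 ≤ p → 2 ^ p ≤ n → ∀ hs → length hs ≡ p → All (1 ≤_) hs →
    Σ (List ℕ) (λ hs′ → hs ≡ hs′ ++ (1 ∷ [])) →
    (1 * p * n * (n !)) ^ p * n ≤ (512 * totalInversions hs n) ^ p
  bound n 4096≤n p 1≤p 2^p≤n .(hs ++ 1 ∷ []) ≡.refl 1≤hs (hs , ≡.refl) =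
    ≤-trans (≤-reflexive (cong (λ q → (q * n * n !) ^ p * n) (*-identityˡ p)))
      -- The two cases are n^(1/p) >= 32 and n^(1/p) < 32.
      ([ bound-large n 4096≤n hs (All.++⁻ˡ hs 1≤hs) 1≤p
       , bound-small n 4096≤n hs (All.++⁻ˡ hs 1≤hs) 2^p≤n ]′ (≤-<-connex (32 ^ p) n))
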